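{- For each fixed integer $\sigma\ge1$, $$G_\sigma(n)\sim\frac{e\,((\sigma+1)n)!}{n!\,((\sigma+1)!)^n}\quad\text{as } n\to\infty.$$
   Context: Gift exchange game with steal limit $\sigma\ge 0$ and $m\ge 1$ gifts: there are $m$ players and $m$ distinct wrapped gifts, initially all in a pool. The players are called one at a time in a fixed order. When a player is called, and also whenever a player's gift has just been stolen, that player (who currently holds no gift) makes a move: either take one of the gifts still in the pool (it is unwrapped and held by that player), or steal an unwrapped gift currently held by another player, provided this gift has so far been stolen fewer than $\sigma$ times in total; the player from whom it was stolen then immediately makes a move. The game ends as soon as the last gift in the pool is taken. A scenario is the complete sequence of moves (which player took which gift at each move). For $n\ge 0$, $G_\sigma(n)$ is the number of scenarios of the game with $m=n+1$ gifts in which the gifts are taken from the pool in the order $1,2,\ldots,n+1$. -}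

module Defs where

open import Data.Nat using (ℕ; zero; suc; _+_; _*_; _^_; _<?_; _≟_; _!)
open import Data.Nat.Properties using (_!≢0)
open import Data.Fin using (Fin; zero; suc)
open import Data.Vec using (Vec; []; _∷_; lookup; _[_]≔_; _∷ʳ_)
open import Data.List using (List; map)
open import Data.Nat.ListAction using (sum)
open import Data.List.Base using (allFin)
open import Relation.Nullary using (yes; no)
open import Data.Integer using (+_)
open import Data.Rational using (ℚ; _/_; 0ℚ) renaming (_+_ to _+ℚ_)

-- Players are numbered 0,1,...,m-1 (the fixed calling order).
-- Gifts are numbered 0,...,m-1 (0-based for 1,...,m); gift k is the
-- (k+1)-st to be taken from the pool.
--
-- A game state after exactly k gifts have been taken from the pool:
--   holder : Vec ℕ k   -- holder i = player currently holding gift i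
--   steals : Vec ℕ k   -- steals i = number of times gift i has been stolen
--   mover  : ℕ         -- the player (holding no gift) who moves now
-- In such a state gifts 0..k-1 are unwrapped and held, gifts k..m-1 are in
-- the pool.  Since the gifts must be taken from the pool in the order
-- 1,2,...,m, the only allowed pool move is to take gift k.
--
-- scenarios σ m fuel k holder steals mover counts the complete move
-- sequences (scenarios) from this state in which the remaining pool gifts
-- are taken in increasing order.  Moves:
--   * take gift k from the pool: if k+1 = m the game ends (one scenario);
--     otherwise player k+1 (the next player in the calling order) is called.
--   * steal gift i (i < k) if steals i < σ: the holder of gift i becomes
--     the mover, gift i passes to the current mover, its steal count +1.
-- The fuel parameter only ensures structural termination; every game has
-- at most m*(σ+1) moves, which is the fuel supplied in G below.
scenarios : (σ m fuel k : ℕ) → Vec ℕ k → Vec ℕ k → ℕ → ℕ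
scenarios σ m zero k holder steals mover = 0
scenarios σ m (suc fuel) k holder steals mover =
  takeMove + sum (map stealMove (allFin k))
  where
    takeMove : ℕ
    takeMove with suc k ≟ m
    ... | yes _ = 1
    ... | no _  = scenarios σ m fuel (suc k) (holder ∷ʳ mover) (steals ∷ʳ 0) (suc k)
    stealMove : Fin k → ℕ
    stealMove i with lookup steals i <? σ
    ... | yes _ = scenarios σ m fuel k (holder [ i ]≔ mover)
                    (steals [ i ]≔ suc (lookup steals i)) (lookup holder i)
    ... | no _  = 0

G : ℕ → ℕ → ℕ
G σ n = scenarios σ (suc n) (suc n * suc σ) 0 [] [] 0

ratio : ℕ → ℕ → ℚ
ratio σ n = (+ (G σ n * (n !) * (((suc σ) !) ^ n))) / ((suc σ * n) !)
  where instance _ = (suc σ * n) !≢0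

-- Partial sums of the series for e:  eApprox N = Σ_{j=0}^{N} 1/j!.
-- (eApprox N → e as N → ∞; e itself is not a rational.)
eApprox : ℕ → ℚ
eApprox zero = + 1 / 1
eApprox (suc N) = eApprox N +ℚ (+ 1 / (suc N !))
  where instance _ = (suc N) !≢0

{-# OPTIONS --safe #-}

-- Dropping the final move, a scenario is a word in which each of n gifts occurs
-- between 1 and s = σ + 1 times, with first occurrences in increasing order.  Hence
-- n! G_σ(n) = L(Qⁿ) with Q = x + x²/2! + ⋯ + xˢ/s! and L the linear functional
-- L(xᵏ) = k!.  The first-move recursion of the game is integration by parts,
-- L(f) = f(0) + L(f′), together with the product rule.
--
-- Split s! Q = U + R with U = s xˢ⁻¹ + xˢ its two leading terms.  In
-- L(Uⁿ)/(sn)! = Σ_j C(n,j) sʲ (sn − j)!/(sn)! the j-th summand lies between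
-- (1 − j(j − 1)/n)/j! and 1/j!, so L(Uⁿ)/(sn)! is within 3/n of the partial sum
-- Σ_{j≤n} 1/j!.  Since (U + R)ⁿ ≤ Uⁿ + n R (U + R)ⁿ⁻¹ coefficientwise and
-- deg R ≤ s − 2, the ratios r_n of the theorem satisfy
-- r_n ≤ L(Uⁿ)/(sn)! + (C/n) r_{n−1}; so they are bounded and R contributes O(1/n).

module Submission where

open import Defs
open import Algebra.Properties.Group using (⁻¹-anti-homo-//)
open import Data.Fin using (Fin; zero; suc)
open import Data.Integer as ℤ using (+≤+; +<+; +[1+_])
  renaming (+_ to pos)
import Data.Integer.Properties as ℤ
open import Data.List using ([]; _∷_; map; allFin)
open import Data.List.Properties using (map-tabulate; map-cong)
open import Data.Nat using (ℕ; zero; suc; _+_; _*_; _∸_; _^_; _!; _≤_; z≤n; s≤s; s≤s⁻¹; _<?_; _≟_; NonZero)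
  renaming (_<_ to _<ℕ_)
open import Data.Nat.Divisibility using (m≤n⇒m!∣n!; ∣⇒≤)
open import Data.Nat.DivMod using (m/n*n≡m; m/n≤m) renaming (_/_ to _/ℕ_)
open import Data.Nat.ListAction using (sum)
open import Data.Nat.Properties
open import Data.Nat.Tactic.RingSolver using (solve-∀)
open import Data.Product using (∃; _×_; _,_)
open import Data.Rational using (ℚ; mkℚ; 0ℚ; _<_; _-_; ∣_∣; _/_; *<*; toℚᵘ)
  renaming (_+_ to _+ℚ_; _≤_ to _≤ℚ_; -_ to -ℚ_)
import Data.Rational.Properties as ℚ
open import Data.Rational.Unnormalised as ℚᵘ using (mkℚᵘ; *≡*; *≤*)
import Data.Rational.Unnormalised.Properties as ℚᵘ
open import Data.Sum using (inj₁; inj₂)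
open import Data.Vec using (Vec; []; _∷_; lookup; _[_]≔_; _∷ʳ_)
open import Data.Vec.Relation.Unary.All using (All; []; _∷_)
open import Function using (_∘_; id)
open import Relation.Binary.PropositionalEquality
open import Relation.Nullary using (yes; no; contradiction)

-- Polynomials acting on the moments L(xᵏ f)

infixl 4 _≐_
_≐_ : (ℕ → ℕ) → (ℕ → ℕ) → Set
φ ≐ ψ = ∀ k → φ k ≡ ψ k

-- If `φ k` = L(xᵏ f), the result is L(xᵏ V f) for V = Σ `v a` xᵃ over a < m. Polynomials are
-- represented only by this action on moments.
shiftSum : (ℕ → ℕ) → ℕ → (ℕ → ℕ) → ℕ → ℕ
shiftSum v zero    φ k = 0
shiftSum v (suc m) φ k = shiftSum v m φ k + v m * φ (k + m)

shiftSum-cong : ∀ v m {φ ψ} → φ ≐ ψ → shiftSum v m φ ≐ shiftSum v m ψ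
shiftSum-cong v zero    eq k = refl
shiftSum-cong v (suc m) eq k =
  cong₂ _+_ (shiftSum-cong v m eq k) (cong (v m *_) (eq (k + m)))

shiftSum-mono : ∀ v m {φ ψ} → (∀ k → φ k ≤ ψ k) → ∀ k → shiftSum v m φ k ≤ shiftSum v m ψ k
shiftSum-mono v zero    φ≤ψ k = z≤n
shiftSum-mono v (suc m) φ≤ψ k =
  +-mono-≤ (shiftSum-mono v m φ≤ψ k) (*-monoʳ-≤ (v m) (φ≤ψ (k + m)))

shiftSum-+ : ∀ v m φ ψ k →
  shiftSum v m (λ k → φ k + ψ k) k ≡ shiftSum v m φ k + shiftSum v m ψ k
shiftSum-+ v zero    φ ψ k = refl
shiftSum-+ v (suc m) φ ψ k rewrite shiftSum-+ v m φ ψ k =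
  arith (shiftSum v m φ k) (shiftSum v m ψ k) (v m) (φ (k + m)) (ψ (k + m))
  where
    arith : ∀ a b c d e → a + b + c * (d + e) ≡ a + c * d + (b + c * e)
    arith = solve-∀

shiftSum-* : ∀ v m c φ k → shiftSum v m (λ k → c * φ k) k ≡ c * shiftSum v m φ k
shiftSum-* v zero    c φ k = sym (*-zeroʳ c)
shiftSum-* v (suc m) c φ k rewrite shiftSum-* v m c φ k =
  arith c (shiftSum v m φ k) (v m) (φ (k + m))
  where
    arith : ∀ c a b d → c * a + b * (c * d) ≡ c * (a + b * d)
    arith = solve-∀

shiftSum-0 : ∀ v m k → shiftSum v m (λ _ → 0) k ≡ 0
shiftSum-0 v m k = shiftSum-* v m 0 (λ _ → 0) k

shiftSum-translate : ∀ v m φ j k → shiftSum v m (λ k → φ (k + j)) k ≡ shiftSum v m φ (k + j)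
shiftSum-translate v zero    φ j k = refl
shiftSum-translate v (suc m) φ j k =
  cong₂ _+_ (shiftSum-translate v m φ j k) (cong (λ x → v m * φ x) (arith k m j))
  where
    arith : ∀ k m j → k + m + j ≡ k + j + m
    arith = solve-∀

-- Multiplying by two polynomials in either order gives the same product.
shiftSum-comm : ∀ u l v m φ → shiftSum u l (shiftSum v m φ) ≐ shiftSum v m (shiftSum u l φ)
shiftSum-comm u zero    v m φ k = sym (shiftSum-0 v m k)
shiftSum-comm u (suc l) v m φ k = begin
  shiftSum u l (shiftSum v m φ) k + u l * shiftSum v m φ (k + l)
    ≡⟨ cong₂ (λ x y → x + u l * y) (shiftSum-comm u l v m φ k)
             (sym (shiftSum-translate v m φ l k)) ⟩
  shiftSum v m (shiftSum u l φ) k + u l * shiftSum v m (λ k → φ (k + l)) k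
    ≡⟨ cong (shiftSum v m (shiftSum u l φ) k +_) (shiftSum-* v m (u l) (λ k → φ (k + l)) k) ⟨
  shiftSum v m (shiftSum u l φ) k + shiftSum v m (λ k → u l * φ (k + l)) k
    ≡⟨ shiftSum-+ v m (shiftSum u l φ) (λ k → u l * φ (k + l)) k ⟨
  shiftSum v m (shiftSum u (suc l) φ) k ∎
  where open ≡-Reasoning

shiftSum-sum : ∀ {A : Set} v m (g : A → ℕ → ℕ) xs k →
  shiftSum v m (λ k → sum (map (λ i → g i k) xs)) k ≡ sum (map (λ i → shiftSum v m (g i) k) xs)
shiftSum-sum v m g []       k = shiftSum-0 v m k
shiftSum-sum v m g (x ∷ xs) k =
  trans (shiftSum-+ v m (g x) (λ k → sum (map (λ i → g i k) xs)) k)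
        (cong (shiftSum v m (g x) k +_) (shiftSum-sum v m g xs k))

sum-allFin-suc : ∀ {n} (f : Fin (suc n) → ℕ) →
  sum (map f (allFin (suc n))) ≡ f zero + sum (map (f ∘ suc) (allFin n))
sum-allFin-suc {n} f =
  cong (λ xs → f zero + sum xs) (trans (map-tabulate {n = n} suc f) (sym (map-tabulate {n = n} id (f ∘ suc))))

-- Integration by parts and the product rule

lower : (ℕ → ℕ) → ℕ → ℕ
lower φ zero    = 0
lower φ (suc k) = suc k * φ k

atZero : ℕ → ℕ → ℕ
atZero c zero    = c
atZero c (suc k) = 0

-- If φ k = L(xᵏ f) for the functional L(xᵏ) = k!, then integration by parts
-- (L g = g(0) + L g′) says  Parts φ (f 0) (k ↦ L(xᵏ f′)).
Parts : (ℕ → ℕ) → ℕ → (ℕ → ℕ) → Set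
Parts φ c φ′ = ∀ k → φ k ≡ atZero c k + lower φ k + φ′ k

-- Product rule (V f)′ = V′ f + V f′, where `v′` lists the coefficients of V′; the boundary value is
-- V(0) f(0). The `lower` term comes from differentiating xᵏ.
parts-shiftSum : ∀ {φ c φ′} v v′ m → (∀ a → a <ℕ m → v′ a ≡ suc a * v (suc a)) → Parts φ c φ′ →
  Parts (shiftSum v (suc m) φ) (v 0 * c)
        (λ k → shiftSum v′ m φ k + shiftSum v (suc m) φ′ k)
parts-shiftSum {φ} {c} {φ′} v v′ zero h p zero
  rewrite p 0 = arith (v 0) c (φ′ 0)
  where
    arith : ∀ v c d → 0 + v * (c + 0 + d) ≡ v * c + 0 + (0 + (0 + v * d))
    arith = solve-∀
parts-shiftSum {φ} {c} {φ′} v v′ zero h p (suc k)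
  rewrite +-identityʳ k | p (suc k) = arith (v 0) (φ k) (φ′ (suc k)) k
  where
    arith : ∀ v x d k → 0 + v * (0 + suc k * x + d) ≡ 0 + suc k * (0 + v * x) + (0 + (0 + v * d))
    arith = solve-∀
parts-shiftSum {φ} {c} {φ′} v v′ (suc m) h p zero
  rewrite parts-shiftSum {φ} {c} {φ′} v v′ m (λ a a<m → h a (m<n⇒m<1+n a<m)) p 0 | p (suc m) | h m ≤-refl =
  arith (v 0 * c) (shiftSum v′ m φ 0) (shiftSum v (suc m) φ′ 0) (v (suc m)) (φ m) (φ′ (suc m)) m
  where
    arith : ∀ c a b w x d m →
      c + 0 + (a + b) + w * (0 + suc m * x + d) ≡ c + 0 + (a + suc m * w * x + (b + w * d))
    arith = solve-∀
parts-shiftSum {φ} {c} {φ′} v v′ (suc m) h p (suc k)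
  rewrite parts-shiftSum {φ} {c} {φ′} v v′ m (λ a a<m → h a (m<n⇒m<1+n a<m)) p (suc k)
        | p (suc k + suc m) | h m ≤-refl | +-suc k m =
  arith (shiftSum v (suc m) φ k) (shiftSum v′ m φ (suc k)) (shiftSum v (suc m) φ′ (suc k))
        (v (suc m)) (φ (suc (k + m))) (φ′ (suc (suc (k + m)))) m k
  where
    arith : ∀ y a b w x d m k →
      0 + suc k * y + (a + b) + w * (0 + suc (suc (k + m)) * x + d) ≡
      0 + suc k * (y + w * x) + (a + suc m * w * x + (b + w * d))
    arith = solve-∀

-- Generating polynomials of the gifts

module _ (σ : ℕ) where

  maxTakes : ℕ
  maxTakes = suc σ

  -- The coefficient 1/a! of a truncated exponential, scaled by s! to stay a natural number; the
  -- division is exact for a ≤ s.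
  weight : ℕ → ℕ
  weight a = (maxTakes ! /ℕ a !) {{a !≢0}}

  weight-! : ∀ {a} → a ≤ maxTakes → weight a * a ! ≡ maxTakes !
  weight-! {a} a≤s = m/n*n≡m {{a !≢0}} (m≤n⇒m!∣n! a≤s)

  -- Differentiating a truncated exponential shortens it by one term and keeps its coefficients, so
  -- `weight` serves as both `v` and `v′` in the product rule.
  weight-suc : ∀ a → a <ℕ maxTakes → weight a ≡ suc a * weight (suc a)
  weight-suc a a<s = *-cancelʳ-≡ _ _ (a !) {{a !≢0}} (begin
    weight a * a !                 ≡⟨ weight-! (<⇒≤ a<s) ⟩
    maxTakes !                            ≡⟨ weight-! a<s ⟨
    weight (suc a) * (suc a !)     ≡⟨ arith (weight (suc a)) (a !) a ⟩
    suc a * weight (suc a) * a !   ∎)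
    where
      open ≡-Reasoning
      arith : ∀ w f a → w * (suc a * f) ≡ suc a * w * f
      arith = solve-∀

  weight-0 : weight 0 ≡ maxTakes !
  weight-0 = trans (sym (*-identityʳ (weight 0))) (weight-! z≤n)

  -- The constant term is dropped because a gift still in the pool has yet to be taken at least
  -- once.
  weight⁺ : ℕ → ℕ
  weight⁺ zero    = 0
  weight⁺ (suc a) = weight (suc a)

  -- block q k = s!^q L(xᵏ (x + x²/2! + ⋯ + xˢ/s!)^q) with s = σ + 1.
  block : ℕ → ℕ → ℕ
  block zero    = _!
  block (suc q) = shiftSum weight⁺ (suc maxTakes) (block q)

  parts-!  : Parts _! 1 (λ _ → 0)
  parts-! zero    = refl
  parts-! (suc k) = sym (+-identityʳ _)

  -- The derivative of Q^(q+1) is (q+1) Q′ Q^q, and s! Q′ is the factor of a gift just unwrapped and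
  -- never stolen. The boundary value is 0 since Q(0) = 0.
  parts-block : ∀ q → Parts (block (suc q)) 0 (λ k → suc q * shiftSum weight maxTakes (block q) k)
  parts-block zero k = trans (parts-shiftSum {_!} weight⁺ weight maxTakes weight-suc parts-! k)
    (cong (atZero 0 k + lower (block 1) k +_) (begin
      shiftSum weight maxTakes _! k + shiftSum weight⁺ (suc maxTakes) (λ _ → 0) k
        ≡⟨ cong (shiftSum weight maxTakes _! k +_) (shiftSum-0 weight⁺ (suc maxTakes) k) ⟩
      shiftSum weight maxTakes _! k + 0 ∎))
    where open ≡-Reasoning
  parts-block (suc q) k = trans (parts-shiftSum {block (suc q)} weight⁺ weight maxTakes weight-suc (parts-block q) k)
    (cong (atZero 0 k + lower (block (suc (suc q))) k +_) (begin
      P (block (suc q)) k + shiftSum weight⁺ (suc maxTakes) (λ k → suc q * P (block q) k) k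
        ≡⟨ cong (P (block (suc q)) k +_) (shiftSum-* weight⁺ (suc maxTakes) (suc q) (P (block q)) k) ⟩
      P (block (suc q)) k + suc q * shiftSum weight⁺ (suc maxTakes) (P (block q)) k
        ≡⟨ cong (λ x → P (block (suc q)) k + suc q * x)
                (shiftSum-comm weight⁺ (suc maxTakes) weight maxTakes (block q) k) ⟩
      P (block (suc q)) k + suc q * P (block (suc q)) k ∎))
    where
      open ≡-Reasoning
      P : (ℕ → ℕ) → ℕ → ℕ
      P = shiftSum weight maxTakes

  -- A gift stolen t times so far contributes the factor s! (1 + x + ⋯ + xʳ/r!), r = σ − t.
  remaining : ∀ {j} → Vec ℕ j → (ℕ → ℕ) → ℕ → ℕ
  remaining []       φ = φ
  remaining (t ∷ ts) φ = shiftSum weight (maxTakes ∸ t) (remaining ts φ)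

  remaining-cong : ∀ {j} (ts : Vec ℕ j) {φ ψ} → φ ≐ ψ → remaining ts φ ≐ remaining ts ψ
  remaining-cong []       eq = eq
  remaining-cong (t ∷ ts) eq = shiftSum-cong weight (maxTakes ∸ t) (remaining-cong ts eq)

  remaining-* : ∀ {j} (ts : Vec ℕ j) c φ k → remaining ts (λ k → c * φ k) k ≡ c * remaining ts φ k
  remaining-* []       c φ k = refl
  remaining-* (t ∷ ts) c φ k =
    trans (shiftSum-cong weight (maxTakes ∸ t) (remaining-* ts c φ) k)
          (shiftSum-* weight (maxTakes ∸ t) c (remaining ts φ) k)

  remaining-∷ʳ : ∀ {j} (ts : Vec ℕ j) t φ →
    remaining (ts ∷ʳ t) φ ≐ remaining ts (shiftSum weight (maxTakes ∸ t) φ)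
  remaining-∷ʳ []       t φ k = refl
  remaining-∷ʳ (u ∷ ts) t φ   = shiftSum-cong weight (maxTakes ∸ u) (remaining-∷ʳ ts t φ)

  stolen : ∀ {j} → Vec ℕ j → Fin j → Vec ℕ j
  stolen ts i = ts [ i ]≔ suc (lookup ts i)

  steals : ∀ {j} → Vec ℕ j → (ℕ → ℕ) → ℕ → ℕ
  steals {j} ts φ k = sum (map (λ i → remaining (stolen ts i) φ k) (allFin j))

  -- Differentiating the factor of one gift shortens it by one term, which is the factor of that
  -- gift after one more steal. So the product rule yields one summand per possible steal, and each
  -- factor contributes s! to the boundary value.
  parts-remaining : ∀ {j φ c φ′} (ts : Vec ℕ j) → All (_≤ σ) ts → Parts φ c φ′ →
    Parts (remaining ts φ) ((maxTakes !) ^ j * c) (λ k → remaining ts φ′ k + steals ts φ k)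
  parts-remaining {φ = φ} {c} {φ′} [] [] p k
    rewrite *-identityˡ c | +-identityʳ (φ′ k) = p k
  parts-remaining {suc j} {φ} {c} {φ′} (t ∷ ts) (t≤σ ∷ ts≤σ) p k = begin
    shiftSum weight (maxTakes ∸ t) ψ k
      ≡⟨ cong (λ m → shiftSum weight m ψ k) s∸t ⟩
    shiftSum weight (suc m) ψ k
      ≡⟨ parts-shiftSum weight weight m (λ a a<m → weight-suc a (≤-trans a<m (≤-trans (m∸n≤m σ t) (n≤1+n σ))))
           (parts-remaining ts ts≤σ p) k ⟩
    atZero (weight 0 * ((maxTakes !) ^ j * c)) k + lower (shiftSum weight (suc m) ψ) k +
      (shiftSum weight m ψ k + shiftSum weight (suc m) (λ k → remaining ts φ′ k + steals ts φ k) k)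
      ≡⟨ cong₂ _+_
           (cong₂ _+_ (cong (λ x → atZero x k)
                        (trans (cong (_* ((maxTakes !) ^ j * c)) weight-0) (sym (*-assoc (maxTakes !) _ c))))
                      (cong (λ m → lower (shiftSum weight m ψ) k) (sym s∸t)))
           (cong (shiftSum weight m ψ k +_)
             (trans (cong (λ m → shiftSum weight m (λ k → remaining ts φ′ k + steals ts φ k) k) (sym s∸t))
                    (shiftSum-+ weight (maxTakes ∸ t) (remaining ts φ′) (steals ts φ) k))) ⟩
    A + (shiftSum weight m ψ k + (remaining (t ∷ ts) φ′ k + shiftSum weight (maxTakes ∸ t) (steals ts φ) k))
      ≡⟨ cong (λ x → A + (shiftSum weight m ψ k + (remaining (t ∷ ts) φ′ k + x)))
              (shiftSum-sum weight (maxTakes ∸ t) (λ i → remaining (stolen ts i) φ) (allFin j) k) ⟩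
    A + (shiftSum weight m ψ k + (remaining (t ∷ ts) φ′ k + tailSteals))
      ≡⟨ cong (A +_) (arith (shiftSum weight m ψ k) (remaining (t ∷ ts) φ′ k) tailSteals) ⟩
    A + (remaining (t ∷ ts) φ′ k + (shiftSum weight m ψ k + tailSteals))
      -- The derivative of the head factor is the summand for stealing the head gift, because
      -- `maxTakes ∸ suc t` computes to `m`.
      ≡⟨ cong (λ x → A + (remaining (t ∷ ts) φ′ k + x))
              (sym (sum-allFin-suc (λ i → remaining (stolen (t ∷ ts) i) φ k))) ⟩
    A + (remaining (t ∷ ts) φ′ k + steals (t ∷ ts) φ k) ∎
    where
      open ≡-Reasoning
      m = σ ∸ t
      ψ = remaining ts φ
      s∸t : maxTakes ∸ t ≡ suc m
      s∸t = +-∸-assoc 1 t≤σ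
      A = atZero ((maxTakes !) ^ suc j * c) k + lower (remaining (t ∷ ts) φ) k
      tailSteals = sum (map (λ i → remaining (t ∷ stolen ts i) φ k) (allFin j))
      arith : ∀ a b c → a + (b + c) ≡ b + (a + c)
      arith = solve-∀

-- The recursion of the game

sum-map-* : ∀ {A : Set} c (f : A → ℕ) xs → c * sum (map f xs) ≡ sum (map (λ x → c * f x) xs)
sum-map-* c f []       = *-zeroʳ c
sum-map-* c f (x ∷ xs) = trans (*-distribˡ-+ c (f x) _) (cong (c * f x +_) (sum-map-* c f xs))

-- `take` and `steal` are top-level copies of the local functions of `scenarios`, so that lemmas can
-- refer to them.
take : (σ m fuel k : ℕ) → Vec ℕ k → Vec ℕ k → ℕ → ℕ
take σ m fuel k holder ts mover with suc k ≟ m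
... | yes _ = 1
... | no _  = scenarios σ m fuel (suc k) (holder ∷ʳ mover) (ts ∷ʳ 0) (suc k)

steal : (σ m fuel k : ℕ) → Vec ℕ k → Vec ℕ k → ℕ → Fin k → ℕ
steal σ m fuel k holder ts mover i with lookup ts i <? σ
... | yes _ = scenarios σ m fuel k (holder [ i ]≔ mover) (stolen σ ts i) (lookup holder i)
... | no _  = 0

-- The where-function stealMove of scenarios cannot be named outside Defs; the
-- underscore is solved to it by the use of steal-≡ in scenarios-suc.
steal-≡ : ∀ σ m fuel k holder ts mover i → _ ≡ steal σ m fuel k holder ts mover i

scenarios-suc : ∀ σ m fuel k holder ts mover →
  scenarios σ m (suc fuel) k holder ts mover ≡
  take σ m fuel k holder ts mover + sum (map (steal σ m fuel k holder ts mover) (allFin k))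
scenarios-suc σ m fuel k holder ts mover with suc k ≟ m
... | yes _ = cong suc (cong sum (map-cong (steal-≡ σ m fuel k holder ts mover) (allFin k)))
... | no _  =
  cong (scenarios σ m fuel (suc k) (holder ∷ʳ mover) (ts ∷ʳ 0) (suc k) +_)
       (cong sum (map-cong (steal-≡ σ m fuel k holder ts mover) (allFin k)))

steal-≡ σ m fuel k holder ts mover i with lookup ts i <? σ
... | yes _ = refl
... | no _  = refl

module _ (σ : ℕ) where

  -- The number of steals that the unwrapped gifts still allow.
  budget : ∀ {k} → Vec ℕ k → ℕ
  budget []       = 0
  budget (t ∷ ts) = (σ ∸ t) + budget ts

  budget-∷ʳ : ∀ {k} (ts : Vec ℕ k) → budget (ts ∷ʳ 0) ≡ budget ts + σ
  budget-∷ʳ []       = +-identityʳ σ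
  budget-∷ʳ (t ∷ ts) = trans (cong (σ ∸ t +_) (budget-∷ʳ ts)) (sym (+-assoc (σ ∸ t) _ σ))

  budget-stolen : ∀ {k} (ts : Vec ℕ k) i → lookup ts i <ℕ σ →
    budget ts ≡ suc (budget (stolen σ ts i))
  budget-stolen (t ∷ ts) zero    t<σ = cong (_+ budget ts) (+-∸-assoc 1 t<σ)
  budget-stolen (t ∷ ts) (suc i) t<σ =
    trans (cong (σ ∸ t +_) (budget-stolen ts i t<σ)) (+-suc (σ ∸ t) _)

  stolen-≤ : ∀ {k} {ts : Vec ℕ k} i → lookup ts i <ℕ σ → All (_≤ σ) ts → All (_≤ σ) (stolen σ ts i)
  stolen-≤ zero    t<σ (_   ∷ ts≤σ) = t<σ ∷ ts≤σ
  stolen-≤ (suc i) t<σ (t≤σ ∷ ts≤σ) = t≤σ ∷ stolen-≤ i t<σ ts≤σ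

  ∷ʳ-≤ : ∀ {k} {ts : Vec ℕ k} → All (_≤ σ) ts → All (_≤ σ) (ts ∷ʳ 0)
  ∷ʳ-≤ []           = z≤n ∷ []
  ∷ʳ-≤ (t≤σ ∷ ts≤σ) = t≤σ ∷ ∷ʳ-≤ ts≤σ

  -- One more steal leaves such a gift an empty factor. Hence the sum in `parts-remaining` may run
  -- over all gifts, although the game forbids these steals.
  remaining-exhausted : ∀ {k} (ts : Vec ℕ k) i φ → σ ≤ lookup ts i →
    remaining σ (stolen σ ts i) φ ≐ λ _ → 0
  remaining-exhausted (t ∷ ts) zero    φ σ≤t k rewrite m≤n⇒m∸n≡0 σ≤t = refl
  remaining-exhausted (t ∷ ts) (suc i) φ σ≤t k =
    trans (shiftSum-cong (weight σ) (maxTakes σ ∸ t) (remaining-exhausted ts i φ σ≤t) k)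
          (shiftSum-0 (weight σ) (maxTakes σ ∸ t) k)

  -- Here q counts the pool gifts other than the last. Integration by parts at exponent 0 mirrors
  -- the choice of the next move: the boundary value is the end of the game, the derivative of Q^q
  -- is a take from the pool, and the derivatives of the other factors are steals. The factor q!
  -- offsets the prescribed order of the pool gifts. The strict fuel bound reserves one move for the
  -- final take.
  count : ∀ fuel q k n (holder ts : Vec ℕ k) mover → All (_≤ σ) ts → q + k ≡ n →
    budget ts + q * maxTakes σ <ℕ fuel →
    (maxTakes σ !) ^ n * (q ! * scenarios σ (suc n) fuel k holder ts mover) ≡ remaining σ ts (block σ q) 0
  count-steals : ∀ fuel q k n (holder ts : Vec ℕ k) mover → All (_≤ σ) ts → q + k ≡ n →
    budget ts + q * maxTakes σ ≤ fuel →
    (maxTakes σ !) ^ n * (q ! * sum (map (steal σ (suc n) fuel k holder ts mover) (allFin k))) ≡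
    steals σ ts (block σ q) 0
  count-steal : ∀ fuel q k n (holder ts : Vec ℕ k) mover → All (_≤ σ) ts → q + k ≡ n →
    budget ts + q * maxTakes σ ≤ fuel → ∀ i →
    (maxTakes σ !) ^ n * q ! * steal σ (suc n) fuel k holder ts mover i ≡
    remaining σ (stolen σ ts i) (block σ q) 0
  count-take : ∀ fuel q k n (holder ts : Vec ℕ k) mover → All (_≤ σ) ts → suc q + k ≡ n →
    budget ts + suc q * maxTakes σ ≤ fuel →
    (maxTakes σ !) ^ n * (suc q ! * take σ (suc n) fuel k holder ts mover) ≡
    remaining σ ts (λ k → suc q * shiftSum (weight σ) (maxTakes σ) (block σ q) k) 0

  count (suc fuel) zero k n holder ts mover ts≤σ refl (s≤s b≤fuel) = begin
    W * (1 * scenarios σ (suc k) (suc fuel) k holder ts mover)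
      ≡⟨ cong (λ x → W * (1 * x)) (scenarios-suc σ (suc k) fuel k holder ts mover) ⟩
    W * (1 * (take σ (suc k) fuel k holder ts mover + S))
      -- Only one gift is left in the pool; taking it ends the game, and this 1 becomes the boundary
      -- value.
      ≡⟨ cong (λ x → W * (1 * (x + S))) last-take ⟩
    W * (1 * (1 + S))
      ≡⟨ arith W S ⟩
    W * 1 + 0 + (0 + W * (1 * S))
      ≡⟨ cong₂ (λ x y → W * 1 + 0 + (x + y)) (sym (remaining-* σ ts 0 (λ _ → 0) 0))
               (count-steals fuel 0 k k holder ts mover ts≤σ refl b≤fuel) ⟩
    W * 1 + 0 + (remaining σ ts (λ _ → 0) 0 + steals σ ts (block σ 0) 0)
      ≡⟨ parts-remaining σ ts ts≤σ (parts-! σ) 0 ⟨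
    remaining σ ts (block σ 0) 0 ∎
    where
      open ≡-Reasoning
      W = (maxTakes σ !) ^ k
      S = sum (map (steal σ (suc k) fuel k holder ts mover) (allFin k))
      last-take : take σ (suc k) fuel k holder ts mover ≡ 1
      last-take with suc k ≟ suc k
      ... | yes _  = refl
      ... | no k≢k = contradiction refl k≢k
      arith : ∀ w x → w * (1 * (1 + x)) ≡ w * 1 + 0 + (0 + w * (1 * x))
      arith = solve-∀
  count (suc fuel) (suc q) k n holder ts mover ts≤σ eq (s≤s b≤fuel) = begin
    W * (suc q ! * scenarios σ (suc n) (suc fuel) k holder ts mover)
      ≡⟨ cong (λ x → W * (suc q ! * x)) (scenarios-suc σ (suc n) fuel k holder ts mover) ⟩
    W * (suc q ! * (T + S))
      ≡⟨ arith W (suc q !) T S ⟩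
    0 + 0 + (W * (suc q ! * T) + W * (suc q ! * S))
      ≡⟨ cong₂ (λ x y → 0 + 0 + (x + y)) (count-take fuel q k n holder ts mover ts≤σ eq b≤fuel)
               (count-steals fuel (suc q) k n holder ts mover ts≤σ eq b≤fuel) ⟩
    0 + 0 + (remaining σ ts (λ k → suc q * shiftSum (weight σ) (maxTakes σ) (block σ q) k) 0
             + steals σ ts (block σ (suc q)) 0)
      -- The boundary value is 0 here since Q(0) = 0; it is spelled as a product to match
      -- `parts-remaining`.
      ≡⟨ cong (λ x → x + 0 + (remaining σ ts (λ k → suc q * shiftSum (weight σ) (maxTakes σ) (block σ q) k) 0
                 + steals σ ts (block σ (suc q)) 0)) (sym (*-zeroʳ ((maxTakes σ !) ^ k))) ⟩
    (maxTakes σ !) ^ k * 0 + 0 + (remaining σ ts (λ k → suc q * shiftSum (weight σ) (maxTakes σ) (block σ q) k) 0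
                           + steals σ ts (block σ (suc q)) 0)
      ≡⟨ parts-remaining σ ts ts≤σ (parts-block σ q) 0 ⟨
    remaining σ ts (block σ (suc q)) 0 ∎
    where
      open ≡-Reasoning
      W = (maxTakes σ !) ^ n
      T = take σ (suc n) fuel k holder ts mover
      S = sum (map (steal σ (suc n) fuel k holder ts mover) (allFin k))
      arith : ∀ w f t x → w * (f * (t + x)) ≡ 0 + 0 + (w * (f * t) + w * (f * x))
      arith = solve-∀

  count-steals fuel q k n holder ts mover ts≤σ eq b≤fuel = begin
    W * (q ! * sum (map f (allFin k)))
      ≡⟨ *-assoc W (q !) _ ⟨
    W * q ! * sum (map f (allFin k))
      ≡⟨ sum-map-* (W * q !) f (allFin k) ⟩
    sum (map (λ i → W * q ! * f i) (allFin k))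
      ≡⟨ cong sum (map-cong (count-steal fuel q k n holder ts mover ts≤σ eq b≤fuel) (allFin k)) ⟩
    steals σ ts (block σ q) 0 ∎
    where
      open ≡-Reasoning
      W = (maxTakes σ !) ^ n
      f = steal σ (suc n) fuel k holder ts mover

  count-steal fuel q k n holder ts mover ts≤σ eq b≤fuel i with lookup ts i <? σ
  ... | no t≮σ = trans (*-zeroʳ ((maxTakes σ !) ^ n * q !))
                       (sym (remaining-exhausted ts i (block σ q) (≮⇒≥ t≮σ) 0))
  ... | yes t<σ = trans (*-assoc ((maxTakes σ !) ^ n) (q !) _)
    (count fuel q k n (holder [ i ]≔ mover) (stolen σ ts i) (lookup holder i) (stolen-≤ i t<σ ts≤σ) eq
      (≤-trans (≤-reflexive (cong (_+ q * maxTakes σ) (sym (budget-stolen ts i t<σ)))) b≤fuel))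

  count-take fuel q k n holder ts mover ts≤σ eq b≤fuel with suc k ≟ suc n
  ... | yes refl = contradiction (sym eq) (<⇒≢ {k} {suc q + k} (s≤s (m≤n+m k q)))
  ... | no _ = begin
    W * (suc q ! * X)
      -- The factor q + 1 split off the factorial is the exponent brought down by differentiating
      -- Q^(q+1).
      ≡⟨ arith W (suc q) (q !) X ⟩
    suc q * (W * (q ! * X))
      ≡⟨ cong (suc q *_) (count fuel q (suc k) n (holder ∷ʳ mover) (ts ∷ʳ 0) (suc k) (∷ʳ-≤ ts≤σ)
                            (trans (+-suc q k) eq) budget-bound) ⟩
    suc q * remaining σ (ts ∷ʳ 0) (block σ q) 0
      ≡⟨ cong (suc q *_) (remaining-∷ʳ σ ts 0 (block σ q) 0) ⟩
    suc q * remaining σ ts (shiftSum (weight σ) (maxTakes σ) (block σ q)) 0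
      ≡⟨ remaining-* σ ts (suc q) (shiftSum (weight σ) (maxTakes σ) (block σ q)) 0 ⟨
    remaining σ ts (λ k → suc q * shiftSum (weight σ) (maxTakes σ) (block σ q) k) 0 ∎
    where
      open ≡-Reasoning
      W = (maxTakes σ !) ^ n
      X = scenarios σ (suc n) fuel (suc k) (holder ∷ʳ mover) (ts ∷ʳ 0) (suc k)
      arith : ∀ w q f x → w * (q * f * x) ≡ q * (w * (f * x))
      arith = solve-∀
      regroup : ∀ b σ q → suc (b + σ + q) ≡ b + (suc σ + q)
      regroup = solve-∀
      -- A take turns the s = σ + 1 moves reserved for a pool gift into σ possible steals, and so
      -- uses up one unit.
      budget-bound : budget (ts ∷ʳ 0) + q * maxTakes σ <ℕ fuel
      budget-bound = ≤-trans (≤-reflexive (trans (cong (λ x → suc (x + q * maxTakes σ)) (budget-∷ʳ ts))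
        (regroup (budget ts) σ (q * maxTakes σ)))) b≤fuel

  -- At the start no gift is unwrapped, so the polynomial of the state is (s! Q)ⁿ. The fuel (n+1)s
  -- exceeds the required ns.
  G-block : ∀ n → G σ n * n ! * (maxTakes σ !) ^ n ≡ block σ n 0
  G-block n = trans (arith (G σ n) (n !) ((maxTakes σ !) ^ n))
    (count (suc n * maxTakes σ) n 0 n [] [] 0 [] (+-identityʳ n) (s≤s (m≤n+m (n * maxTakes σ) σ)))
    where
      arith : ∀ g f w → g * f * w ≡ w * (f * g)
      arith = solve-∀

-- Binomial sums and partial sums of the exponential series

!-mono-≤ : ∀ {m n} → m ≤ n → m ! ≤ n !
!-mono-≤ {m} {n} m≤n = ∣⇒≤ {{n !≢0}} (m≤n⇒m!∣n! m≤n)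

-- Σⱼ C(n,j) f(j), generated by Pascal's rule without explicit coefficients.
binomialSum : ℕ → (ℕ → ℕ) → ℕ
binomialSum zero    f = f 0
binomialSum (suc n) f = binomialSum n f + binomialSum n (f ∘ suc)

binomialSum-* : ∀ n c f → binomialSum n (λ j → c * f j) ≡ c * binomialSum n f
binomialSum-* zero    c f = refl
binomialSum-* (suc n) c f =
  trans (cong₂ _+_ (binomialSum-* n c f) (binomialSum-* n c (f ∘ suc)))
        (sym (*-distribˡ-+ c (binomialSum n f) _))

-- n ! times the sum of f j / j ! over j ≤ n.
factorialSum : ℕ → (ℕ → ℕ) → ℕ
factorialSum zero    f = f 0
factorialSum (suc n) f = suc n * factorialSum n f + f (suc n)

factorialSum-cong : ∀ n {f g} → f ≐ g → factorialSum n f ≡ factorialSum n g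
factorialSum-cong zero    eq = eq 0
factorialSum-cong (suc n) eq = cong₂ _+_ (cong (suc n *_) (factorialSum-cong n eq)) (eq (suc n))

factorialSum-mono : ∀ n {f g} → (∀ j → j ≤ n → f j ≤ g j) → factorialSum n f ≤ factorialSum n g
factorialSum-mono zero    f≤g = f≤g 0 z≤n
factorialSum-mono (suc n) f≤g =
  +-mono-≤ (*-monoʳ-≤ (suc n) (factorialSum-mono n (λ j j≤n → f≤g j (m≤n⇒m≤1+n j≤n))))
           (f≤g (suc n) ≤-refl)

factorialSum-+ : ∀ n f g → factorialSum n (λ j → f j + g j) ≡ factorialSum n f + factorialSum n g
factorialSum-+ zero    f g = refl
factorialSum-+ (suc n) f g rewrite factorialSum-+ n f g =
  arith n (factorialSum n f) (factorialSum n g) (f (suc n)) (g (suc n))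
  where
    arith : ∀ n a b c d → suc n * (a + b) + (c + d) ≡ suc n * a + c + (suc n * b + d)
    arith = solve-∀

factorialSum-* : ∀ n c f → factorialSum n (λ j → c * f j) ≡ c * factorialSum n f
factorialSum-* zero    c f = refl
factorialSum-* (suc n) c f rewrite factorialSum-* n c f =
  arith n c (factorialSum n f) (f (suc n))
  where
    arith : ∀ n c a b → suc n * (c * a) + c * b ≡ c * (suc n * a + b)
    arith = solve-∀

-- Reindexing by j/j! = 1/(j-1)!.
factorialSum-lower : ∀ n f → factorialSum (suc n) (lower f) ≡ suc n * factorialSum n f
factorialSum-lower zero    f = refl
factorialSum-lower (suc n) f rewrite factorialSum-lower n f =
  sym (*-distribˡ-+ (suc (suc n)) (suc n * factorialSum n f) (f (suc n)))

-- The numerator of `eApprox n` over the denominator n!.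
eNumerator : ℕ → ℕ
eNumerator n = factorialSum n (λ _ → 1)

factorialSum-const : ∀ n c → factorialSum n (λ _ → c) ≡ c * eNumerator n
factorialSum-const n c =
  trans (factorialSum-cong n (λ _ → sym (*-identityʳ c))) (factorialSum-* n c (λ _ → 1))

-- Strictness drives the induction: multiplied by m ≥ 2, a gap of 1 grows to at least 2, which
-- covers the new term 1 and restores the gap.
eNumerator-bound : ∀ n → eNumerator n <ℕ 3 * n !
eNumerator-bound zero          = s≤s (s≤s z≤n)
eNumerator-bound (suc zero)    = ≤-refl
eNumerator-bound (suc (suc n)) = begin
  suc (m * e + 1)   ≡⟨ regroup (m * e) ⟩
  m * e + 2         ≤⟨ +-monoʳ-≤ (m * e) (s≤s (s≤s (z≤n {n}))) ⟩
  m * e + m         ≡⟨ regroup′ m e ⟩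
  m * suc e         ≤⟨ *-monoʳ-≤ m (eNumerator-bound (suc n)) ⟩
  m * (3 * suc n !) ≡⟨ regroup″ m (suc n !) ⟩
  3 * (m * suc n !) ∎
  where
    open ≤-Reasoning
    m = suc (suc n)
    e = eNumerator (suc n)
    regroup : ∀ x → suc (x + 1) ≡ x + 2
    regroup = solve-∀
    regroup′ : ∀ m e → m * e + m ≡ m * suc e
    regroup′ = solve-∀
    regroup″ : ∀ m e → m * (3 * e) ≡ 3 * (m * e)
    regroup″ = solve-∀

falling : ℕ → ℕ → ℕ
falling n       zero    = 1
falling zero    (suc j) = 0
falling (suc n) (suc j) = suc n * falling n j

falling-suc : ∀ n j → falling n (suc j) + j * falling n j ≡ n * falling n j
falling-suc zero    zero    = refl
falling-suc zero    (suc j) = *-zeroʳ j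
falling-suc (suc n) zero    = +-identityʳ _
falling-suc (suc n) (suc j) = begin
  suc n * falling n (suc j) + suc j * (suc n * falling n j)
    ≡⟨ arith n j (falling n (suc j)) (falling n j) ⟩
  suc n * (falling n (suc j) + j * falling n j) + suc n * falling n j
    ≡⟨ cong (λ x → suc n * x + suc n * falling n j) (falling-suc n j) ⟩
  suc n * (n * falling n j) + suc n * falling n j
    ≡⟨ arith′ n (falling n j) ⟩
  suc n * (suc n * falling n j) ∎
  where
    open ≡-Reasoning
    arith : ∀ n j x y → suc n * x + suc j * (suc n * y) ≡ suc n * (x + j * y) + suc n * y
    arith = solve-∀
    arith′ : ∀ n y → suc n * (n * y) + suc n * y ≡ suc n * (suc n * y)
    arith′ = solve-∀

-- Pascal's rule multiplied by (j+1)!.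
falling-pascal : ∀ n j → falling (suc n) (suc j) ≡ falling n (suc j) + suc j * falling n j
falling-pascal n j = begin
  falling n j + n * falling n j                          ≡⟨ cong (falling n j +_) (falling-suc n j) ⟨
  falling n j + (falling n (suc j) + j * falling n j)    ≡⟨ arith (falling n j) (falling n (suc j)) j ⟩
  falling n (suc j) + suc j * falling n j                ∎
  where
    open ≡-Reasoning
    arith : ∀ x y j → x + (y + j * x) ≡ y + suc j * x
    arith = solve-∀

-- C(n,j) = `falling n j` / j!. The range N is kept apart from n because Pascal's rule calls for the
-- sums of order n with both N and N + 1; terms with j > n vanish.
binomialSum-falling : ∀ n N f → n ≤ N →
  N ! * binomialSum n f ≡ factorialSum N (λ j → falling n j * f j)
binomialSum-falling zero    zero    f _ = refl
binomialSum-falling zero    (suc N) f _ = begin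
  suc N * N ! * f 0        ≡⟨ *-assoc (suc N) (N !) (f 0) ⟩
  suc N * (N ! * f 0)      ≡⟨ cong (suc N *_) (binomialSum-falling zero N f z≤n) ⟩
  suc N * factorialSum N (λ j → falling 0 j * f j)
                           ≡⟨ +-identityʳ _ ⟨
  suc N * factorialSum N (λ j → falling 0 j * f j) + 0 ∎
  where open ≡-Reasoning
binomialSum-falling (suc n) (suc N) f (s≤s n≤N) = begin
  suc N ! * (binomialSum n f + binomialSum n (f ∘ suc))
    ≡⟨ arith N (N !) (binomialSum n f) (binomialSum n (f ∘ suc)) ⟩
  suc N ! * binomialSum n f + suc N * (N ! * binomialSum n (f ∘ suc))
    ≡⟨ cong₂ (λ x y → x + suc N * y) (binomialSum-falling n (suc N) f (m≤n⇒m≤1+n n≤N))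
             (binomialSum-falling n N (f ∘ suc) n≤N) ⟩
  factorialSum (suc N) (λ j → falling n j * f j) + suc N * factorialSum N (λ j → falling n j * f (suc j))
    ≡⟨ cong (factorialSum (suc N) (λ j → falling n j * f j) +_)
            (factorialSum-lower N (λ j → falling n j * f (suc j))) ⟨
  factorialSum (suc N) (λ j → falling n j * f j) + factorialSum (suc N) (lower (λ j → falling n j * f (suc j)))
    ≡⟨ factorialSum-+ (suc N) (λ j → falling n j * f j) (lower (λ j → falling n j * f (suc j))) ⟨
  factorialSum (suc N) (λ j → falling n j * f j + lower (λ j → falling n j * f (suc j)) j)
    ≡⟨ factorialSum-cong (suc N) pascal ⟩
  factorialSum (suc N) (λ j → falling (suc n) j * f j) ∎
  where
    open ≡-Reasoning
    arith : ∀ N x a b → suc N * x * (a + b) ≡ suc N * x * a + suc N * (x * b)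
    arith = solve-∀
    distrib : ∀ x y j z → x * z + suc j * (y * z) ≡ (x + suc j * y) * z
    distrib = solve-∀
    pascal : (λ j → falling n j * f j + lower (λ j → falling n j * f (suc j)) j)
           ≐ (λ j → falling (suc n) j * f j)
    pascal zero    = +-identityʳ _
    pascal (suc j) = trans (distrib (falling n (suc j)) (falling n j) j (f (suc j)))
                           (cong (_* f (suc j)) (sym (falling-pascal n j)))

-- Termwise bounds for polynomial multiples

shiftSum-growth : ∀ v m φ k c → (∀ a → a <ℕ m → φ (suc (k + a)) ≤ c * φ (k + a)) →
  shiftSum v m φ (suc k) ≤ c * shiftSum v m φ k
shiftSum-growth v zero    φ k c h = z≤n
shiftSum-growth v (suc m) φ k c h = begin
  shiftSum v m φ (suc k) + v m * φ (suc (k + m))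
    ≤⟨ +-mono-≤ (shiftSum-growth v m φ k c (λ a a<m → h a (m<n⇒m<1+n a<m)))
                (*-monoʳ-≤ (v m) (h m ≤-refl)) ⟩
  c * shiftSum v m φ k + v m * (c * φ (k + m))
    ≡⟨ arith c (shiftSum v m φ k) (v m) (φ (k + m)) ⟩
  c * (shiftSum v m φ k + v m * φ (k + m)) ∎
  where
    open ≤-Reasoning
    arith : ∀ c a b d → c * a + b * (c * d) ≡ c * (a + b * d)
    arith = solve-∀

shiftSum-bound : ∀ v m φ w x y → (∀ a → a <ℕ m → v a ≤ w) → (∀ a → a <ℕ m → x * φ a ≤ y) →
  x * shiftSum v m φ 0 ≤ m * w * y
shiftSum-bound v zero    φ w x y v≤w φ≤y = ≤-reflexive (*-zeroʳ x)
shiftSum-bound v (suc m) φ w x y v≤w φ≤y = begin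
  x * (shiftSum v m φ 0 + v m * φ m)
    ≡⟨ arith x (shiftSum v m φ 0) (v m) (φ m) ⟩
  x * shiftSum v m φ 0 + v m * (x * φ m)
    ≤⟨ +-mono-≤ (shiftSum-bound v m φ w x y (λ a a<m → v≤w a (m<n⇒m<1+n a<m)) (λ a a<m → φ≤y a (m<n⇒m<1+n a<m)))
                (*-mono-≤ (v≤w m ≤-refl) (φ≤y m ≤-refl)) ⟩
  m * w * y + w * y
    ≡⟨ arith′ m w y ⟩
  suc m * w * y ∎
  where
    open ≤-Reasoning
    arith : ∀ x a b c → x * (a + b * c) ≡ x * a + b * (x * c)
    arith = solve-∀
    arith′ : ∀ m w y → m * w * y + w * y ≡ suc m * w * y
    arith′ = solve-∀

-- Separating the two leading terms from the rest

module _ (p : ℕ) where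

  private
    σ : ℕ
    σ = suc p
    S : ℕ
    S = suc σ
    b : ℕ → ℕ → ℕ
    b = block σ

  -- Multiplication by U.
  topTwo : (ℕ → ℕ) → ℕ → ℕ
  topTwo φ k = S * φ (k + σ) + φ (k + S)

  -- Multiplication by R, whose exponents stop at σ - 1 = s - 2.
  rest : (ℕ → ℕ) → ℕ → ℕ
  rest = shiftSum (weight⁺ σ) σ

  weight-top : weight σ S ≡ 1
  weight-top = *-cancelʳ-≡ (weight σ S) 1 (S !) {{S !≢0}}
    (trans (weight-! σ {S} ≤-refl) (sym (*-identityˡ (S !))))

  weight-next : weight σ σ ≡ S
  weight-next = trans (weight-suc σ σ ≤-refl) (trans (cong (S *_) weight-top) (*-identityʳ S))

  shiftSum-split : ∀ φ k → shiftSum (weight⁺ σ) (suc S) φ k ≡ rest φ k + topTwo φ k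
  shiftSum-split φ k = begin
    rest φ k + weight σ σ * φ (k + σ) + weight σ S * φ (k + S)
      ≡⟨ cong₂ (λ x y → rest φ k + x * φ (k + σ) + y * φ (k + S)) weight-next weight-top ⟩
    rest φ k + S * φ (k + σ) + 1 * φ (k + S)
      ≡⟨ arith (rest φ k) (S * φ (k + σ)) (φ (k + S)) ⟩
    rest φ k + topTwo φ k ∎
    where
      open ≡-Reasoning
      arith : ∀ a b c → a + b + 1 * c ≡ a + (b + c)
      arith = solve-∀

  -- The moments L(xᵏ Uⁿ).
  main : ℕ → ℕ → ℕ
  main zero    = _!
  main (suc n) = topTwo (main n)

  topTwo-mono : ∀ {φ ψ} → (∀ k → φ k ≤ ψ k) → ∀ k → topTwo φ k ≤ topTwo ψ k
  topTwo-mono φ≤ψ k = +-mono-≤ (*-monoʳ-≤ S (φ≤ψ (k + σ))) (φ≤ψ (k + S))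

  main≤block : ∀ n k → main n k ≤ b n k
  main≤block zero    k = ≤-refl
  main≤block (suc n) k = begin
    topTwo (main n) k                ≤⟨ topTwo-mono (main≤block n) k ⟩
    topTwo (b n) k                   ≤⟨ m≤n+m _ (rest (b n) k) ⟩
    rest (b n) k + topTwo (b n) k    ≡⟨ shiftSum-split (b n) k ⟨
    b (suc n) k                      ∎
    where open ≤-Reasoning

  -- Bernoulli's inequality (x + y)ⁿ⁺¹ ≤ xⁿ⁺¹ + (n + 1) y (x + y)ⁿ, coefficientwise.
  block≤main+rest : ∀ n k → b (suc n) k ≤ main (suc n) k + suc n * rest (b n) k
  block≤main+rest zero k = ≤-reflexive (trans (shiftSum-split (b 0) k)
    (trans (+-comm (rest (b 0) k) _) (cong (main 1 k +_) (sym (*-identityˡ (rest (b 0) k))))))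
  block≤main+rest (suc n) k = begin
    b (suc (suc n)) k
      ≡⟨ shiftSum-split (b (suc n)) k ⟩
    r + topTwo (b (suc n)) k
      ≤⟨ +-monoʳ-≤ r (topTwo-mono (block≤main+rest n) k) ⟩
    r + topTwo (λ k → main (suc n) k + suc n * rest (b n) k) k
      ≡⟨ arith r S (suc n) (main (suc n) (k + σ)) (main (suc n) (k + S)) (rest (b n) (k + σ)) (rest (b n) (k + S)) ⟩
    main (suc (suc n)) k + (r + suc n * topTwo (rest (b n)) k)
      ≤⟨ +-monoʳ-≤ (main (suc (suc n)) k) (+-monoʳ-≤ r (*-monoʳ-≤ (suc n) commute)) ⟩
    main (suc (suc n)) k + suc (suc n) * r ∎
    where
      open ≤-Reasoning
      r = rest (b (suc n)) k
      commute : topTwo (rest (b n)) k ≤ r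
      commute = begin
        -- U R ≤ (U + R) R coefficientwise, and R then commutes past U + R.
        topTwo (rest (b n)) k                              ≤⟨ m≤n+m _ (rest (rest (b n)) k) ⟩
        rest (rest (b n)) k + topTwo (rest (b n)) k        ≡⟨ shiftSum-split (rest (b n)) k ⟨
        shiftSum (weight⁺ σ) (suc S) (rest (b n)) k        ≡⟨ shiftSum-comm (weight⁺ σ) (suc S) (weight⁺ σ) σ (b n) k ⟩
        r                                                  ∎
      arith : ∀ r s n a b c d →
        r + (s * (a + n * c) + (b + n * d)) ≡ s * a + b + (r + n * (s * c + d))
      arith = solve-∀

  -- Multiplying a monomial xⁱ by x multiplies its L-value by i + 1, and every monomial here has
  -- degree at most nS + k.
  block-growth : ∀ n k → b n (suc k) ≤ suc (n * S + k) * b n k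
  block-growth zero    k = ≤-refl
  block-growth (suc n) k = shiftSum-growth (weight⁺ σ) (suc S) (b n) k (suc (suc n * S + k)) λ a a<sS → begin
    b n (suc (k + a))                   ≤⟨ block-growth n (k + a) ⟩
    suc (n * S + (k + a)) * b n (k + a)   ≤⟨ *-monoˡ-≤ (b n (k + a)) (s≤s (bound a (s≤s⁻¹ a<sS))) ⟩
    suc (suc n * S + k) * b n (k + a)     ∎
    where
      open ≤-Reasoning
      arith : ∀ x k y → x + (k + y) ≡ y + x + k
      arith = solve-∀
      bound : ∀ a → a ≤ S → n * S + (k + a) ≤ suc n * S + k
      bound a a≤S = ≤-trans (+-monoʳ-≤ (n * S) (+-monoʳ-≤ k a≤S)) (≤-reflexive (arith (n * S) k S))

  block-shift : ∀ n a → (n * S) ! * b n a ≤ b n 0 * (n * S + a) !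
  block-shift n zero rewrite +-identityʳ (n * S) = ≤-reflexive (*-comm ((n * S) !) (b n 0))
  block-shift n (suc a) rewrite +-suc (n * S) a = begin
    (n * S) ! * b n (suc a)                          ≤⟨ *-monoʳ-≤ ((n * S) !) (block-growth n a) ⟩
    (n * S) ! * (c * b n a)                ≡⟨ arith ((n * S) !) c (b n a) ⟩
    c * ((n * S) ! * b n a)                ≤⟨ *-monoʳ-≤ c (block-shift n a) ⟩
    c * (b n 0 * (n * S + a) !)            ≡⟨ arith c (b n 0) ((n * S + a) !) ⟩
    b n 0 * (c * (n * S + a) !)            ∎
    where
      open ≤-Reasoning
      c = suc (n * S + a)
      arith : ∀ x y z → x * (y * z) ≡ y * (x * z)
      arith = solve-∀

  -- The number of coefficients listed for R times a bound on each.
  restConst : ℕ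
  restConst = σ * S !

  -- Since deg R ≤ s - 2, the factorial (nS + a)! falls short of ((n+1)S)! by at least two factors,
  -- each at least n + 1. One of them will pay for the factor n + 1 in Bernoulli's inequality, and
  -- the other gives the decay.
  rest-bound : ∀ n → (n * S) ! * (suc n * suc n) * rest (b n) 0 ≤ restConst * (b n 0 * (suc n * S) !)
  rest-bound n = shiftSum-bound (weight⁺ σ) σ (b n) (S !)
    ((n * S) ! * (suc n * suc n)) (b n 0 * (suc n * S) !) (λ a _ → weight≤ a) λ a a<σ → begin
    (n * S) ! * (suc n * suc n) * b n a
      ≡⟨ arith ((n * S) !) (suc n * suc n) (b n a) ⟩
    suc n * suc n * ((n * S) ! * b n a)
      ≤⟨ *-mono-≤ (*-mono-≤ (bound a 1) (bound a 0)) (block-shift n a) ⟩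
    suc (suc (n * S + a)) * suc (n * S + a) * (b n 0 * (n * S + a) !)
      ≡⟨ arith′ (suc (suc (n * S + a))) (suc (n * S + a)) (b n 0) ((n * S + a) !) ⟩
    b n 0 * (suc (suc (n * S + a))) !
      ≤⟨ *-monoʳ-≤ (b n 0) (!-mono-≤ (top a a<σ)) ⟩
    b n 0 * (suc n * S) ! ∎
    where
      open ≤-Reasoning
      weight≤ : ∀ a → weight⁺ σ a ≤ S !
      weight≤ zero    = z≤n
      weight≤ (suc a) = m/n≤m (S !) (suc a !) {{suc a !≢0}}
      bound : ∀ a c → suc n ≤ c + suc (n * S + a)
      bound a c = ≤-trans (s≤s (≤-trans (m≤m*n n S) (m≤m+n (n * S) a))) (m≤n+m _ c)
      arith : ∀ x y z → x * y * z ≡ y * (x * z)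
      arith = solve-∀
      arith′ : ∀ x y z w → x * y * (z * w) ≡ z * (x * (y * w))
      arith′ = solve-∀
      regroup : ∀ x a → suc (suc (x + a)) ≡ suc (suc a) + x
      regroup = solve-∀
      top : ∀ a → a <ℕ σ → suc (suc (n * S + a)) ≤ suc n * S
      top a a<σ = ≤-trans (≤-reflexive (regroup (n * S) a)) (+-monoˡ-≤ (n * S) (s≤s a<σ))

  -- The main term L(Uⁿ)

  term : ℕ → ℕ → ℕ
  term K j = S ^ j * (K ∸ j) !

  -- Binomial expansion of xᵏ Uⁿ: choosing the lower term of U in j factors gives sʲ and lowers the
  -- exponent nS + k by j.
  main-binomial : ∀ n k → main n k ≡ binomialSum n (term (n * S + k))
  main-binomial zero    k = sym (*-identityˡ (k !))
  main-binomial (suc n) k = begin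
    S * main n (k + σ) + main n (k + S)
      ≡⟨ +-comm (S * main n (k + σ)) _ ⟩
    main n (k + S) + S * main n (k + σ)
      ≡⟨ cong₂ (λ x y → x + S * y) (main-binomial n (k + S)) (main-binomial n (k + σ)) ⟩
    binomialSum n (term (n * S + (k + S))) + S * binomialSum n (term (n * S + (k + σ)))
      ≡⟨ cong₂ (λ x y → binomialSum n (term x) + S * binomialSum n (term y))
               (arith (n * S) k S) (arith (n * S) k σ) ⟩
    binomialSum n (term (suc n * S + k)) + S * binomialSum n (term (σ + n * S + k))
      ≡⟨ cong (binomialSum n (term (suc n * S + k)) +_) (binomialSum-* n S (term (σ + n * S + k))) ⟨
    binomialSum n (term (suc n * S + k)) + binomialSum n (λ j → S * term (σ + n * S + k) j)
      ≡⟨ cong (binomialSum n (term (suc n * S + k)) +_)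
              (binomialSum-cong n (λ j → sym (*-assoc S (S ^ j) _))) ⟩
    binomialSum (suc n) (term (suc n * S + k)) ∎
    where
      open ≡-Reasoning
      arith : ∀ x k y → x + (k + y) ≡ y + x + k
      arith = solve-∀
      binomialSum-cong : ∀ n {f g} → f ≐ g → binomialSum n f ≡ binomialSum n g
      binomialSum-cong zero    eq = eq 0
      binomialSum-cong (suc n) eq = cong₂ _+_ (binomialSum-cong n eq) (binomialSum-cong n (eq ∘ suc))

  module _ (n : ℕ) where

    private
      M : ℕ
      M = n * S

    -- j! times the j-th summand of L(Uⁿ); it is compared with M! = (sn)!.
    summand : ℕ → ℕ
    summand j = falling n j * term M j

    main-summand : n ! * main n 0 ≡ factorialSum n summand
    main-summand = begin
      n ! * main n 0                     ≡⟨ cong (n ! *_) (main-binomial n 0) ⟩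
      n ! * binomialSum n (term (M + 0)) ≡⟨ cong (λ K → n ! * binomialSum n (term K)) (+-identityʳ M) ⟩
      n ! * binomialSum n (term M)       ≡⟨ binomialSum-falling n n (term M) ≤-refl ⟩
      factorialSum n summand             ∎
      where open ≡-Reasoning

    -- The quotient of consecutive summands is s(n - j)/(sn - j); with i = n - j - 1 the denominator
    -- reads i + 1 + σn.
    summand-suc : ∀ j i → j + suc i ≡ n →
      suc (i + σ * n) * summand (suc j) ≡ S * suc i * summand j
    summand-suc j i refl = begin
      suc (i + σ * n) * (falling n (suc j) * (S * S ^ j * (M ∸ suc j) !))
        ≡⟨ cong₂ (λ x y → suc (i + σ * n) * (x * (S * S ^ j * y !))) falls
                 (trans (cong (_∸ suc j) (split′ j i σ)) (m+n∸m≡n (suc j) (i + σ * n))) ⟩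
      suc (i + σ * n) * (suc i * falling n j * (S * S ^ j * (i + σ * n) !))
        ≡⟨ arith (suc (i + σ * n)) (suc i) (falling n j) S (S ^ j) ((i + σ * n) !) ⟩
      S * suc i * (falling n j * (S ^ j * suc (i + σ * n) !))
        ≡⟨ cong (λ y → S * suc i * (falling n j * (S ^ j * y !)))
                (trans (cong (_∸ j) (split j i σ)) (m+n∸m≡n j (suc (i + σ * n)))) ⟨
      S * suc i * summand j ∎
      where
        open ≡-Reasoning
        split : ∀ j i σ → (j + suc i) * suc σ ≡ j + suc (i + σ * (j + suc i))
        split = solve-∀
        split′ : ∀ j i σ → (j + suc i) * suc σ ≡ suc j + (i + σ * (j + suc i))
        split′ = solve-∀
        arith : ∀ d i f s t x → d * (i * f * (s * t * x)) ≡ s * i * (f * (t * (d * x)))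
        arith = solve-∀
        distrib : ∀ j i f → (j + suc i) * f ≡ suc i * f + j * f
        distrib = solve-∀
        falls : falling n (suc j) ≡ suc i * falling n j
        falls = +-cancelʳ-≡ (j * falling n j) _ _ (trans (falling-suc n j) (distrib j i (falling n j)))

    summand-decreasing : ∀ j i → j + suc i ≡ n → summand (suc j) ≤ summand j
    summand-decreasing j i eq = *-cancelˡ-≤ (suc (i + σ * n)) (begin
      suc (i + σ * n) * summand (suc j)  ≡⟨ summand-suc j i eq ⟩
      S * suc i * summand j              ≤⟨ *-monoˡ-≤ (summand j) (+-monoʳ-≤ (suc i) (*-monoʳ-≤ σ
                                              (≤-trans (m≤n+m (suc i) j) (≤-reflexive eq)))) ⟩
      suc (i + σ * n) * summand j        ∎)
      where open ≤-Reasoning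

    summand≤ : ∀ j i → j + i ≡ n → summand j ≤ M !
    summand≤ zero    i eq = ≤-reflexive (trans (*-identityˡ _) (*-identityˡ _))
    summand≤ (suc j) i eq = ≤-trans (summand-decreasing j i eq′) (summand≤ j (suc i) eq′)
      where
        eq′ : j + suc i ≡ n
        eq′ = trans (+-suc j i) eq

    -- The quotient of consecutive summands is at least 1 - j/n.
    summand-step : ∀ j i → j + suc i ≡ n → n * summand j ≤ n * summand (suc j) + j * summand j
    summand-step j i eq = *-cancelˡ-≤ d (begin
      d * (n * summand j)
        -- Adding exactly this slack turns the inequality into a polynomial identity, which rests on
        -- `d` + j = nS.
        ≤⟨ m≤m+n _ (j * suc i * summand j) ⟩
      d * (n * summand j) + j * suc i * summand j
        ≡⟨ arith n eq (summand j) ⟩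
      n * (S * suc i * summand j) + d * (j * summand j)
        ≡⟨ cong (λ x → n * x + d * (j * summand j)) (summand-suc j i eq) ⟨
      n * (d * summand (suc j)) + d * (j * summand j)
        ≡⟨ arith′ n d (summand (suc j)) (j * summand j) ⟩
      d * (n * summand (suc j) + j * summand j) ∎)
      where
        open ≤-Reasoning
        d = suc (i + σ * n)
        arith″ : ∀ j i σ x → suc (i + σ * (j + suc i)) * ((j + suc i) * x) + j * suc i * x ≡
          (j + suc i) * (suc σ * suc i * x) + suc (i + σ * (j + suc i)) * (j * x)
        arith″ = solve-∀
        arith : ∀ n → j + suc i ≡ n → ∀ x → suc (i + σ * n) * (n * x) + j * suc i * x ≡
          n * (S * suc i * x) + suc (i + σ * n) * (j * x)
        arith _ refl x = arith″ j i σ x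
        arith′ : ∀ n d x y → n * (d * x) + d * y ≡ d * (n * x + y)
        arith′ = solve-∀

    -- pairs j = j (j − 1).
    pairs : ℕ → ℕ
    pairs = lower (lower (λ _ → 1))

    pairs-suc : ∀ j → pairs j + j ≤ pairs (suc j)
    pairs-suc zero    = z≤n
    pairs-suc (suc j) = ≤-trans (m≤m+n _ (suc j)) (≤-reflexive (arith j (lower (λ _ → 1) j) (lower-1 j)))
      where
        lower-1 : ∀ j → lower (λ _ → 1) j ≡ j
        lower-1 zero    = refl
        lower-1 (suc j) = *-identityʳ (suc j)
        arith′ : ∀ j → suc j * j + suc j + suc j ≡ suc (suc j) * (suc j * 1)
        arith′ = solve-∀
        arith : ∀ j l → l ≡ j → suc j * l + suc j + suc j ≡ suc (suc j) * (suc j * 1)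
        arith j _ refl = arith′ j

    -- The step from j to j + 1 loses at most j M!, and the accumulated loss 0 + 1 + ⋯ + (j-1) is at
    -- most j(j-1).
    summand≥ : ∀ j i → j + i ≡ n → n * M ! ≤ n * summand j + M ! * pairs j
    summand≥ zero    i eq =
      ≤-trans (≤-reflexive (cong (n *_) (sym (trans (*-identityˡ _) (*-identityˡ _))))) (m≤m+n _ _)
    summand≥ (suc j) i eq = begin
      n * M !                                                    ≤⟨ summand≥ j (suc i) eq′ ⟩
      n * summand j + M ! * pairs j                              ≤⟨ +-monoˡ-≤ _ (summand-step j i eq′) ⟩
      n * summand (suc j) + j * summand j + M ! * pairs j        ≤⟨ +-monoˡ-≤ _ (+-monoʳ-≤ (n * summand (suc j))
                                                                      (*-monoʳ-≤ j (summand≤ j (suc i) eq′))) ⟩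
      n * summand (suc j) + j * M ! + M ! * pairs j              ≡⟨ arith (n * summand (suc j)) j (M !) (pairs j) ⟩
      n * summand (suc j) + M ! * (pairs j + j)                  ≤⟨ +-monoʳ-≤ (n * summand (suc j))
                                                                      (*-monoʳ-≤ (M !) (pairs-suc j)) ⟩
      n * summand (suc j) + M ! * pairs (suc j)                  ∎
      where
        open ≤-Reasoning
        eq′ : j + suc i ≡ n
        eq′ = trans (+-suc j i) eq
        arith : ∀ x j m q → x + j * m + m * q ≡ x + m * (q + j)
        arith = solve-∀

    main-upper : n ! * main n 0 ≤ M ! * eNumerator n
    main-upper = begin
      n ! * main n 0               ≡⟨ main-summand ⟩
      factorialSum n summand       ≤⟨ factorialSum-mono n (λ j j≤n → summand≤ j (n ∸ j) (m+[n∸m]≡n j≤n)) ⟩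
      factorialSum n (λ _ → M !)   ≡⟨ factorialSum-const n (M !) ⟩
      M ! * eNumerator n           ∎
      where open ≤-Reasoning

    -- Reindexing twice by j(j-1)/j! = 1/(j-2)! leaves a partial sum for e, which is below 3.
    pairs-sum : ∀ N → factorialSum N pairs ≤ 3 * N !
    pairs-sum zero          = z≤n
    pairs-sum (suc zero)    = z≤n
    pairs-sum (suc (suc N)) = begin
      factorialSum (suc (suc N)) pairs
        ≡⟨ factorialSum-lower (suc N) (lower (λ _ → 1)) ⟩
      suc (suc N) * factorialSum (suc N) (lower (λ _ → 1))
        ≡⟨ cong (suc (suc N) *_) (factorialSum-lower N (λ _ → 1)) ⟩
      suc (suc N) * (suc N * eNumerator N)
        ≤⟨ *-monoʳ-≤ (suc (suc N)) (*-monoʳ-≤ (suc N) (<⇒≤ (eNumerator-bound N))) ⟩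
      suc (suc N) * (suc N * (3 * N !))
        ≡⟨ arith (suc (suc N)) (suc N) (N !) ⟩
      3 * suc (suc N) ! ∎
      where
        open ≤-Reasoning
        arith : ∀ x y z → x * (y * (3 * z)) ≡ 3 * (x * (y * z))
        arith = solve-∀

    -- The termwise lower bounds are summed with weights 1/j!; `pairs-sum` supplies the constant 3.
    main-lower : n * (M ! * eNumerator n) ≤ n * (n ! * main n 0) + 3 * (n ! * M !)
    main-lower = begin
      n * (M ! * eNumerator n)
        ≡⟨ *-assoc n (M !) _ ⟨
      n * M ! * eNumerator n
        ≡⟨ factorialSum-const n (n * M !) ⟨
      factorialSum n (λ _ → n * M !)
        ≤⟨ factorialSum-mono n (λ j j≤n → summand≥ j (n ∸ j) (m+[n∸m]≡n j≤n)) ⟩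
      factorialSum n (λ j → n * summand j + M ! * pairs j)
        ≡⟨ factorialSum-+ n (λ j → n * summand j) (λ j → M ! * pairs j) ⟩
      factorialSum n (λ j → n * summand j) + factorialSum n (λ j → M ! * pairs j)
        ≡⟨ cong₂ _+_ (factorialSum-* n n summand) (factorialSum-* n (M !) pairs) ⟩
      n * factorialSum n summand + M ! * factorialSum n pairs
        ≤⟨ +-mono-≤ (≤-reflexive (cong (n *_) (sym main-summand))) (*-monoʳ-≤ (M !) (pairs-sum n)) ⟩
      n * (n ! * main n 0) + M ! * (3 * n !)
        ≡⟨ cong (n * (n ! * main n 0) +_) (arith (M !) (n !)) ⟩
      n * (n ! * main n 0) + 3 * (n ! * M !) ∎
      where
        open ≤-Reasoning
        arith : ∀ x y → x * (3 * y) ≡ 3 * (y * x)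
        arith = solve-∀

  -- Boundedness of the ratios and the rate 1/n

  -- Bernoulli's inequality multiplied by m = n + 1 puts m² in front of the rest, which the two
  -- factors gained in `rest-bound` absorb.
  scaled-upper : ∀ n B → b n 0 ≤ B * (n * S) ! →
    suc n * b (suc n) 0 ≤ suc n * main (suc n) 0 + restConst * B * (suc n * S) !
  scaled-upper n B b≤B = begin
    m * b m 0
      ≤⟨ *-monoʳ-≤ m (block≤main+rest n 0) ⟩
    m * (main m 0 + m * rest (b n) 0)
      ≡⟨ arith m (main m 0) (rest (b n) 0) ⟩
    m * main m 0 + m * m * rest (b n) 0
      ≤⟨ +-monoʳ-≤ (m * main m 0) (*-cancelˡ-≤ Y {{(n * S) !≢0}} rest≤) ⟩
    m * main m 0 + restConst * B * (m * S) ! ∎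
    where
      open ≤-Reasoning
      m = suc n
      Y = (n * S) !
      arith : ∀ m x r → m * (x + m * r) ≡ m * x + m * m * r
      arith = solve-∀
      arith′ : ∀ c B Y Z → c * (B * Y * Z) ≡ Y * (c * B * Z)
      arith′ = solve-∀
      rest≤ : Y * (m * m * rest (b n) 0) ≤ Y * (restConst * B * (m * S) !)
      rest≤ = begin
        Y * (m * m * rest (b n) 0)          ≡⟨ *-assoc Y (m * m) _ ⟨
        Y * (m * m) * rest (b n) 0          ≤⟨ rest-bound n ⟩
        restConst * (b n 0 * (m * S) !)     ≤⟨ *-monoʳ-≤ restConst (*-monoˡ-≤ ((m * S) !) b≤B) ⟩
        restConst * (B * Y * (m * S) !)     ≡⟨ arith′ restConst B Y ((m * S) !) ⟩
        Y * (restConst * B * (m * S) !)     ∎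

  main≤3 : ∀ n → main n 0 ≤ 3 * (n * S) !
  main≤3 n = *-cancelˡ-≤ (n !) {{n !≢0}} (begin
    n ! * main n 0               ≤⟨ main-upper n ⟩
    (n * S) ! * eNumerator n     ≤⟨ *-monoʳ-≤ ((n * S) !) (<⇒≤ (eNumerator-bound n)) ⟩
    (n * S) ! * (3 * n !)        ≡⟨ arith ((n * S) !) (n !) ⟩
    n ! * (3 * (n * S) !)        ∎)
    where
      open ≤-Reasoning
      arith : ∀ x y → x * (3 * y) ≡ y * (3 * x)
      arith = solve-∀

  -- The new ratio is at most 3 + CB/m with C = `restConst`; both parts are at most B/2 under the
  -- two hypotheses.
  bound-step : ∀ n B → 2 * restConst ≤ suc n → 6 ≤ B →
    b n 0 ≤ B * (n * S) ! → b (suc n) 0 ≤ B * (suc n * S) !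
  bound-step n B 2c≤m 6≤B b≤B = *-cancelˡ-≤ m (begin
    m * b m 0
      ≤⟨ scaled-upper n B b≤B ⟩
    m * main m 0 + restConst * B * Y
      ≤⟨ +-monoˡ-≤ _ (*-monoʳ-≤ m (main≤3 m)) ⟩
    m * (3 * Y) + restConst * B * Y
      ≡⟨ arith m restConst B Y ⟩
    (m * 3 + restConst * B) * Y
      ≤⟨ *-monoˡ-≤ Y halves ⟩
    m * B * Y
      ≡⟨ *-assoc m B Y ⟩
    m * (B * Y) ∎)
    where
      open ≤-Reasoning
      m = suc n
      Y = (m * S) !
      arith : ∀ m c B Y → m * (3 * Y) + c * B * Y ≡ (m * 3 + c * B) * Y
      arith = solve-∀
      arith′ : ∀ m c B → 2 * (m * 3 + c * B) ≡ m * 6 + 2 * c * B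
      arith′ = solve-∀
      arith″ : ∀ m B → m * B + m * B ≡ 2 * (m * B)
      arith″ = solve-∀
      halves : m * 3 + restConst * B ≤ m * B
      halves = *-cancelˡ-≤ 2 (begin
        2 * (m * 3 + restConst * B)      ≡⟨ arith′ m restConst B ⟩
        m * 6 + 2 * restConst * B        ≤⟨ +-mono-≤ (*-monoʳ-≤ m 6≤B) (*-monoˡ-≤ B 2c≤m) ⟩
        m * B + m * B                    ≡⟨ arith″ m B ⟩
        2 * (m * B)                      ∎)

  block-bounded : ∃ λ B → ∀ i → b (i + 2 * restConst) 0 ≤ B * ((i + 2 * restConst) * S) !
  block-bounded = B , bounded
    where
      N = 2 * restConst
      -- The 6 serves `bound-step`; the other summand makes the base case hold, as factorials are at
      -- least 1.
      B = 6 + b N 0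
      bounded : ∀ i → b (i + N) 0 ≤ B * ((i + N) * S) !
      bounded zero    = ≤-trans (m≤n+m (b N 0) 6) (m≤m*n B ((N * S) !) {{(N * S) !≢0}})
      bounded (suc i) = bound-step (i + N) B (m≤n+m N (suc i)) (m≤m+n 6 (b N 0)) (bounded i)

  -- With denominators cleared: the ratio and `eApprox n` differ by at most D/n.
  block-asymptotics : ∃ λ D → ∃ λ N → ∀ n → N ≤ n →
    n * (b n 0 * n !) ≤ n * (eNumerator n * (n * S) !) + D * (n ! * (n * S) !) ×
    n * (eNumerator n * (n * S) !) ≤ n * (b n 0 * n !) + D * (n ! * (n * S) !)
  block-asymptotics with block-bounded
  -- D adds the error from R, needed above, and the error 3 of the main term, needed below. The
  -- threshold is a successor because the upper bound uses boundedness at the preceding index.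
  ... | B , bounded = restConst * B + 3 , suc (2 * restConst) , λ where
      (suc n) (s≤s N≤n) → upper n (subst (λ n → b n 0 ≤ B * (n * S) !) (m∸n+n≡m N≤n) (bounded (n ∸ 2 * restConst)))
                        , lower-bound (suc n)
    where
      open ≤-Reasoning
      D = restConst * B + 3
      upper : ∀ n → b n 0 ≤ B * (n * S) ! → suc n * (b (suc n) 0 * suc n !) ≤
        suc n * (eNumerator (suc n) * (suc n * S) !) + D * (suc n ! * (suc n * S) !)
      upper n b≤B = begin
        m * (b m 0 * F)
          ≡⟨ *-assoc m (b m 0) F ⟨
        m * b m 0 * F
          ≤⟨ *-monoˡ-≤ F (scaled-upper n B b≤B) ⟩
        (m * main m 0 + restConst * B * Y) * F
          ≡⟨ arith m (main m 0) (restConst * B) Y F ⟩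
        m * (F * main m 0) + restConst * B * (F * Y)
          ≤⟨ +-mono-≤ (*-monoʳ-≤ m (main-upper m)) (*-monoˡ-≤ (F * Y) (m≤m+n (restConst * B) 3)) ⟩
        m * (Y * eNumerator m) + D * (F * Y)
          ≡⟨ cong (λ x → m * x + D * (F * Y)) (*-comm Y (eNumerator m)) ⟩
        m * (eNumerator m * Y) + D * (F * Y) ∎
        where
          m = suc n
          Y = (m * S) !
          F = m !
          arith : ∀ m x c Y F → (m * x + c * Y) * F ≡ m * (F * x) + c * (F * Y)
          arith = solve-∀
      lower-bound : ∀ n → n * (eNumerator n * (n * S) !) ≤ n * (b n 0 * n !) + D * (n ! * (n * S) !)
      lower-bound n = begin
        n * (eNumerator n * Y)
          ≡⟨ cong (n *_) (*-comm (eNumerator n) Y) ⟩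
        n * (Y * eNumerator n)
          ≤⟨ main-lower n ⟩
        n * (n ! * main n 0) + 3 * (n ! * Y)
          ≤⟨ +-mono-≤ (*-monoʳ-≤ n (*-monoʳ-≤ (n !) (main≤block n 0)))
                      (*-monoˡ-≤ (n ! * Y) (m≤n+m 3 (restConst * B))) ⟩
        n * (n ! * b n 0) + D * (n ! * Y)
          ≡⟨ cong (λ x → n * x + D * (n ! * Y)) (*-comm (n !) (b n 0)) ⟩
        n * (b n 0 * n !) + D * (n ! * Y) ∎
        where
          Y = (n * S) !

-- Passage to rational numbers

/-≡ : ∀ a b c d .{{_ : NonZero b}} .{{_ : NonZero d}} →
  a * d ≡ c * b → pos a / b ≡ pos c / d
/-≡ a (suc b) c (suc d) eq = ℚ.fromℚᵘ-cong {mkℚᵘ (pos a) b} {mkℚᵘ (pos c) d}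
  (*≡* (trans (sym (ℤ.pos-* a (suc d))) (trans (cong pos eq) (ℤ.pos-* c (suc b)))))

/-≤ : ∀ a b c d .{{_ : NonZero b}} .{{_ : NonZero d}} →
  a * d ≤ c * b → pos a / b ≤ℚ pos c / d
/-≤ a (suc b) c (suc d) le = ℚ.toℚᵘ-cancel-≤ (begin
  toℚᵘ (pos a / suc b)   ≃⟨ ℚ.toℚᵘ-fromℚᵘ (mkℚᵘ (pos a) b) ⟩
  mkℚᵘ (pos a) b         ≤⟨ *≤* (subst₂ ℤ._≤_ (ℤ.pos-* a (suc d)) (ℤ.pos-* c (suc b)) (+≤+ le)) ⟩
  mkℚᵘ (pos c) d         ≃⟨ ℚ.toℚᵘ-fromℚᵘ (mkℚᵘ (pos c) d) ⟨
  toℚᵘ (pos c / suc d)   ∎)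
  where open ℚᵘ.≤-Reasoning

/-+ : ∀ a b c d .{{_ : NonZero b}} .{{_ : NonZero d}} .{{_ : NonZero (b * d)}} →
  pos a / b +ℚ pos c / d ≡ pos (a * d + c * b) / (b * d)
/-+ a (suc b) c (suc d) = ℚ.toℚᵘ-injective (begin
  toℚᵘ (pos a / suc b +ℚ pos c / suc d)
    ≈⟨ ℚ.toℚᵘ-homo-+ (pos a / suc b) (pos c / suc d) ⟩
  toℚᵘ (pos a / suc b) ℚᵘ.+ toℚᵘ (pos c / suc d)
    ≈⟨ ℚᵘ.+-cong (ℚ.toℚᵘ-fromℚᵘ (mkℚᵘ (pos a) b)) (ℚ.toℚᵘ-fromℚᵘ (mkℚᵘ (pos c) d)) ⟩
  mkℚᵘ (pos a) b ℚᵘ.+ mkℚᵘ (pos c) d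
    ≡⟨ cong (λ x → mkℚᵘ x (d + b * suc d))
         (trans (cong₂ ℤ._+_ (sym (ℤ.pos-* a (suc d))) (sym (ℤ.pos-* c (suc b))))
                (sym (ℤ.pos-+ (a * suc d) (c * suc b)))) ⟩
  mkℚᵘ (pos (a * suc d + c * suc b)) (d + b * suc d)
    ≈⟨ ℚ.toℚᵘ-fromℚᵘ (mkℚᵘ (pos (a * suc d + c * suc b)) (d + b * suc d)) ⟨
  toℚᵘ (pos (a * suc d + c * suc b) / (suc b * suc d)) ∎)
  where open ℚᵘ.≃-Reasoning

eApprox-fraction : ∀ n → eApprox n ≡ (pos (eNumerator n) / n !) {{n !≢0}}
eApprox-fraction zero    = refl
eApprox-fraction (suc n) = begin
  eApprox n +ℚ pos 1 / suc n !
    ≡⟨ cong (_+ℚ (pos 1 / suc n !)) (eApprox-fraction n) ⟩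
  pos e / n ! +ℚ pos 1 / suc n !
    ≡⟨ /-+ e (n !) 1 (suc n !) ⟩
  pos (e * suc n ! + 1 * n !) / (n ! * suc n !)
    ≡⟨ /-≡ (e * suc n ! + 1 * n !) (n ! * suc n !) (suc n * e + 1) (suc n !) (arith e n (n !)) ⟩
  pos (suc n * e + 1) / suc n ! ∎
  where
    open ≡-Reasoning
    e = eNumerator n
    instance
      _ = n !≢0
      _ = suc n !≢0
      _ = m*n≢0 (n !) (suc n !)
    arith : ∀ e n f → (e * (suc n * f) + 1 * f) * (suc n * f) ≡
      (suc n * e + 1) * (f * (suc n * f))
    arith = solve-∀

-- The factors n! and (s!)ⁿ of `ratio` are the ones that `G-block` absorbs.
ratio-fraction : ∀ σ n → ratio σ n ≡ (pos (block σ n 0) / (n * suc σ) !) {{(n * suc σ) !≢0}}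
ratio-fraction σ n = /-≡ (G σ n * n ! * (suc σ !) ^ n) ((suc σ * n) !) (block σ n 0) ((n * suc σ) !)
  {{(suc σ * n) !≢0}} {{(n * suc σ) !≢0}}
  (cong₂ _*_ (G-block σ n) (cong _! (*-comm n (suc σ))))

-- The hypothesis is the conclusion multiplied by n b d, with the negative term moved across.
/-diff : ∀ a b c d D n .{{_ : NonZero b}} .{{_ : NonZero d}} .{{_ : NonZero n}} →
  n * (a * d) ≤ n * (c * b) + D * (d * b) → pos a / b - pos c / d ≤ℚ pos D / n
/-diff a b c d D n h = begin
  x - y                     ≤⟨ ℚ.+-monoˡ-≤ (-ℚ y) x≤ ⟩
  y +ℚ z - y                ≡⟨ cong (_- y) (ℚ.+-comm y z) ⟩
  z +ℚ y - y                ≡⟨ ℚ.+-assoc z y (-ℚ y) ⟩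
  z +ℚ (y - y)              ≡⟨ cong (z +ℚ_) (ℚ.+-inverseʳ y) ⟩
  z +ℚ 0ℚ                   ≡⟨ ℚ.+-identityʳ z ⟩
  z                         ∎
  where
    open ℚ.≤-Reasoning
    instance _ = m*n≢0 d n
    x = pos a / b
    y = pos c / d
    z = pos D / n
    arith : ∀ a d n → a * (d * n) ≡ n * (a * d)
    arith = solve-∀
    arith′ : ∀ b c d D n → n * (c * b) + D * (d * b) ≡ (c * n + D * d) * b
    arith′ = solve-∀
    x≤ : x ≤ℚ y +ℚ z
    x≤ = subst (x ≤ℚ_) (sym (/-+ c d D n))
      (/-≤ a b (c * n + D * d) (d * n)
        (≤-trans (≤-reflexive (arith a d n)) (≤-trans h (≤-reflexive (arith′ b c d D n)))))

∣-∣< : ∀ x y {ε} → x - y < ε → y - x < ε → ∣ x - y ∣ < ε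
∣-∣< x y x-y<ε y-x<ε with ℚ.∣p∣≡p∨∣p∣≡-p (x - y)
... | inj₁ eq = subst (_< _) (sym eq) x-y<ε
... | inj₂ eq = subst (_< _) (sym (trans eq neg)) y-x<ε
  where
    neg : -ℚ (x - y) ≡ y - x
    neg = ⁻¹-anti-homo-// ℚ.+-0-group x y

archimedean : ∀ D ε → 0ℚ < ε → ∃ λ N → ∀ n .{{_ : NonZero n}} → N ≤ n → pos D / n < ε
-- For ε = (p+1)/(q+1) it suffices that D(q+1) < n, since n ≤ (p+1)n.
archimedean D ε@(mkℚ +[1+ p ] q _) _ = suc (D * suc q) , small
  where
    open ℚᵘ.≤-Reasoning
    small : ∀ n .{{_ : NonZero n}} → suc (D * suc q) ≤ n → pos D / n < ε
    small n@(suc n-1) N≤n = ℚ.toℚᵘ-cancel-< (begin-strict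
      toℚᵘ (pos D / n)     ≃⟨ ℚ.toℚᵘ-fromℚᵘ (mkℚᵘ (pos D) n-1) ⟩
      mkℚᵘ (pos D) n-1     <⟨ ℚᵘ.*<* (subst₂ ℤ._<_ (ℤ.pos-* D (suc q)) (ℤ.pos-* (suc p) n)
                              (+<+ (≤-trans N≤n (m≤n*m n (suc p))))) ⟩
      toℚᵘ ε             ∎)
archimedean D (mkℚ (pos 0) q _) (*<* (+<+ ()))
archimedean D (mkℚ (ℤ.-[1+ p ]) q _) (*<* ())

theorem4 : (σ : ℕ) → 1 ≤ σ → (ε : ℚ) → 0ℚ < ε →
    ∃ λ N → (n : ℕ) → N ≤ n → ∣ ratio σ n - eApprox n ∣ < ε
theorem4 (suc p) (s≤s z≤n) ε 0<ε with block-asymptotics p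
... | D , N , bounds with archimedean D ε 0<ε
-- The sum dominates both thresholds, and the successor makes n nonzero, so that D/n is defined.
... | N′ , D/n<ε = suc (N + N′) , λ where
  n@(suc _) N≤n →
    let b≤e , e≤b = bounds n (≤-trans (m≤n⇒m≤1+n (m≤m+n N N′)) N≤n)
        small     = D/n<ε n (≤-trans (m≤n⇒m≤1+n (m≤n+m N′ N)) N≤n)
        Y         = (n * suc (suc p)) !
        instance
          _ = n !≢0
          _ = (n * suc (suc p)) !≢0
    in subst₂ (λ x y → ∣ x - y ∣ < ε) (sym (ratio-fraction (suc p) n)) (sym (eApprox-fraction n))
         (∣-∣< (pos (block (suc p) n 0) / Y) (pos (eNumerator n) / n !)
               (ℚ.≤-<-trans (/-diff (block (suc p) n 0) Y (eNumerator n) (n !) D n b≤e) small)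
               (ℚ.≤-<-trans (/-diff (eNumerator n) (n !) (block (suc p) n 0) Y D n
                 (subst (λ z → n * (eNumerator n * Y) ≤ n * (block (suc p) n 0 * n !) + D * z)
                        (*-comm (n !) Y) e≤b)) small))
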